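{- For every uncountable cardinal $\kappa$, there exists a coloring $c:[\kappa]^2\to\omega$ such that $c''(A\otimes B)=\omega$ for any $A,B\subseteq\kappa$ of order type $\omega_1$ with $\sup A=\sup B$ such that both $A$ and $B$ are stationary in their common supremum.
   Context: $[\kappa]^2$ is the set of two-element subsets of $\kappa$, identified with pairs $(\alpha,\beta)$ with $\alpha<\beta<\kappa$. For sets of ordinals $A,B$, $A\otimes B=\{(\alpha,\beta):\alpha<\beta,\ \alpha\in A,\ \beta\in B\}$, and $c''(A\otimes B)=\{c(\alpha,\beta):(\alpha,\beta)\in A\otimes B\}$. A set $A$ of ordinals is stationary in a limit ordinal $\delta$ of uncountable cofinality if $A\cap\delta$ meets every closed unbounded subset of $\delta$. (If $A$ has order type $\omega_1$, then $\sup A$ has cofinality $\omega_1$.) -}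

module Defs where

open import Data.Nat using (ℕ)
open import Data.Product using (∃; ∃-syntax; _×_; proj₁)
open import Function.Bundles using (Bijection; Injection)
open import Induction.WellFounded using (WellFounded)
open import Level using (Level; suc)
open import Relation.Binary using (Rel; Setoid; IsStrictTotalOrder)
import Relation.Binary.Construct.Add.Supremum.Strict as AddSupremum
import Relation.Binary.Construct.On as On
import Relation.Binary.Construct.StrictToNonStrict as StrictToNonStrict
open import Relation.Binary.Morphism.Structures using (IsOrderIsomorphism)
open import Relation.Binary.PropositionalEquality using (_≡_; setoid)
open import Relation.Nullary using (¬_)
open import Relation.Nullary.Construct.Add.Supremum using (_⁺; [_]; ⊤⁺)
open import Relation.Unary using (Pred; _∈_; _⊆_)

-- An ordinal is presented by a well-ordered type, whose elements play the
-- role of the smaller ordinals.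
record Ordinal (ℓ : Level) : Set (suc ℓ) where
  infix 4 _<_
  field
    Carrier            : Set ℓ
    _<_                : Rel Carrier ℓ
    isStrictTotalOrder : IsStrictTotalOrder _≡_ _<_
    wellFounded        : WellFounded _<_

  open AddSupremum _<_ public using (_<⁺_)
  open StrictToNonStrict (_≡_ {A = Carrier ⁺}) _<⁺_ public
    using () renaming (_≤_ to _≤⁺_)

  -- The ordinals at most κ: [ α ] is the element α of κ, and ⊤⁺ is κ itself.
  Carrier⁺ : Set ℓ
  Carrier⁺ = Carrier ⁺

module _ {ℓ : Level} (κ : Ordinal ℓ) where
  open Ordinal κ

  Subset : Set (suc ℓ)
  Subset = Pred Carrier ℓ

  -- The von Neumann ordinal δ = { α : α < δ }, as a subset of κ.
  Below : Carrier⁺ → Subset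
  Below δ α = [ α ] <⁺ δ

  -- Equality of elements ignores the proof of membership.
  elements : Subset → Setoid ℓ ℓ
  elements A = On.setoid (setoid Carrier) (proj₁ {B = A})

  Countable : Subset → Set ℓ
  Countable A = Injection (elements A) (setoid ℕ)

  -- Cardinals are initial ordinals.
  IsCardinal : Set ℓ
  IsCardinal = ∀ α → ¬ Bijection (elements (Below ⊤⁺)) (elements (Below [ α ]))

  IsUncountable : Set ℓ
  IsUncountable = ¬ Countable (Below ⊤⁺)

  HasOrderType : Subset → Carrier⁺ → Set ℓ
  HasOrderType A τ =
    ∃[ f ] IsOrderIsomorphism
             (Setoid._≈_ (elements (Below τ))) (Setoid._≈_ (elements A))
             (λ ξ η → proj₁ ξ < proj₁ η) (λ α β → proj₁ α < proj₁ β)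
             f

  -- The first uncountable ordinal; it is at most κ when κ is uncountable.
  IsOmega₁ : Carrier⁺ → Set ℓ
  IsOmega₁ τ =
    ¬ Countable (Below τ) × (∀ α → [ α ] <⁺ τ → Countable (Below [ α ]))

  HasOrderTypeω₁ : Subset → Set ℓ
  HasOrderTypeω₁ A = ∃[ ω₁ ] IsOmega₁ ω₁ × HasOrderType A ω₁

  UpperBound : Subset → Carrier⁺ → Set ℓ
  UpperBound A δ = ∀ α → α ∈ A → [ α ] ≤⁺ δ

  IsSup : Subset → Carrier⁺ → Set ℓ
  IsSup A δ = UpperBound A δ × (∀ γ → UpperBound A γ → δ ≤⁺ γ)

  UnboundedIn : Subset → Carrier⁺ → Set ℓ
  UnboundedIn C δ =
    ∀ α → [ α ] <⁺ δ → ∃[ β ] β ∈ C × α < β × [ β ] <⁺ δ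

  -- Unboundedness is by strictly larger elements, so a nonzero γ in which C
  -- is unbounded is automatically a limit, with sup (C ∩ γ) = γ.
  ClosedIn : Subset → Carrier⁺ → Set ℓ
  ClosedIn C δ =
    ∀ γ → [ γ ] <⁺ δ → (∃[ α ] α < γ) → UnboundedIn C [ γ ] → γ ∈ C

  IsClub : Subset → Carrier⁺ → Set ℓ
  IsClub C δ = C ⊆ Below δ × UnboundedIn C δ × ClosedIn C δ

  -- Intended for limit δ of uncountable cofinality, such as the supremum of
  -- a set of order type ω₁.
  StationaryIn : Subset → Carrier⁺ → Set (suc ℓ)
  StationaryIn A δ =
    ∀ (C : Subset) → IsClub C δ → ∃[ α ] α ∈ A × [ α ] <⁺ δ × α ∈ C

  -- [κ]², as pairs (α , β) with α < β; the proof is irrelevant, so that a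
  -- function on [κ]² depends on α and β only.
  record Pairs : Set ℓ where
    constructor pair
    field
      α β  : Carrier
      .α<β : α < β

  _⊗_ : Subset → Subset → Pred Pairs ℓ
  (A ⊗ B) p = Pairs.α p ∈ A × Pairs.β p ∈ B

  Coloring : Set ℓ
  Coloring = Pairs → ℕ

  Image : Coloring → Pred Pairs ℓ → Pred ℕ ℓ
  Image c P n = ∃[ p ] p ∈ P × c p ≡ n

-- Fix for each α of cofinality ω a ladder, i.e. a sequence cofinal in α, and for
-- α < β count the intervals between consecutive ladder points of β below α which
-- contain a ladder point of α.  In the ladders of stationary many elements of A
-- (or of B), after a bounded initial segment the next point can be taken
-- arbitrarily large; pressing down bounds it again on a stationary subset.
-- Extending the two sides in turn raises the count by exactly one each time.
-- Hence, with an error m depending only on A and B, the count takes a value in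
-- [ n , n + m ] for every n, and it remains to compose it with a function ω → ω
-- which has arbitrarily long plateaus at every value.

module Submission where

open import Defs
open import Axiom.ExcludedMiddle using (ExcludedMiddle)
open import Data.Empty using (⊥-elim)
open import Data.Nat as ℕ using (ℕ; zero; suc; z≤n; s≤s)
import Data.Nat.Properties as ℕ
open import Data.Product using (Σ-syntax; ∃; ∃-syntax; _×_; _,_; proj₁; proj₂)
open import Data.Sum using (_⊎_; inj₁; inj₂)
open import Data.Unit using (tt)
open import Function using (_∘_)
open import Function.Bundles using (Injection)
open import Level using (Level; Lift; lift; lower)
open import Relation.Binary using (IsStrictTotalOrder; tri<; tri≈; tri>)
import Relation.Binary.Construct.Add.Supremum.Strict as AddSupremum
open import Relation.Binary.Morphism.Structures using (IsOrderIsomorphism)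
open import Relation.Binary.PropositionalEquality
  using (_≡_; refl; sym; trans; cong; subst; subst₂)
open import Relation.Nullary using (¬_; yes; no; contradiction)
open import Relation.Nullary.Construct.Add.Supremum using ([_])
open import Relation.Nullary.Decidable using (map′; decidable-stable)
open import Relation.Unary using (U; _≐_; _∈_; _⊆_; _∩_)

private
  variable
    a b ℓ : Level

lowerEM : ExcludedMiddle (a Level.⊔ b) → ExcludedMiddle a
lowerEM {b = b} em {P} = map′ lower lift (em {Lift b P})

-- Blocks of squares and a pairing function.

m≤m*m : ∀ m → m ℕ.≤ m ℕ.* m
m≤m*m zero      = z≤n
m≤m*m m@(suc _) = ℕ.m≤m*n m m

-- The block of `s` ends at `s * s + s`, which is below `suc s * suc s`; so the blocks are disjoint
-- and in order.
square+-< : ∀ {s s′ r} r′ → r ℕ.≤ s → s ℕ.< s′ → s ℕ.* s ℕ.+ r ℕ.< s′ ℕ.* s′ ℕ.+ r′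
square+-< {s} {s′} {r} r′ r≤s s<s′ = begin-strict
  s ℕ.* s ℕ.+ r        ≤⟨ ℕ.+-monoʳ-≤ (s ℕ.* s) r≤s ⟩
  s ℕ.* s ℕ.+ s        ≡⟨ ℕ.+-comm (s ℕ.* s) s ⟩
  suc s ℕ.* s          <⟨ ℕ.*-monoʳ-< (suc s) (ℕ.n<1+n s) ⟩
  suc s ℕ.* suc s      ≤⟨ ℕ.*-mono-≤ s<s′ s<s′ ⟩
  s′ ℕ.* s′            ≤⟨ ℕ.m≤m+n _ r′ ⟩
  s′ ℕ.* s′ ℕ.+ r′     ∎
  where open ℕ.≤-Reasoning

square+-injective : ∀ {s s′ r r′} → r ℕ.≤ s → r′ ℕ.≤ s′ →
                    s ℕ.* s ℕ.+ r ≡ s′ ℕ.* s′ ℕ.+ r′ → s ≡ s′ × r ≡ r′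
square+-injective {s} {s′} {r} {r′} r≤s r′≤s′ eq with ℕ.<-cmp s s′
... | tri< s<s′ _ _ = contradiction eq (ℕ.<⇒≢ (square+-< r′ r≤s s<s′))
... | tri> _ _ s′<s = contradiction (sym eq) (ℕ.<⇒≢ (square+-< r r′≤s′ s′<s))
... | tri≈ _ refl _ = refl , ℕ.+-cancelˡ-≡ (s ℕ.* s) r r′ eq

-- A pairing: `m` is the offset inside the block of `m + n`.
code : ℕ → ℕ → ℕ
code m n = (m ℕ.+ n) ℕ.* (m ℕ.+ n) ℕ.+ m

code-injective : ∀ {m n m′ n′} → code m n ≡ code m′ n′ → m ≡ m′ × n ≡ n′
code-injective {m} {n} {m′} {n′} eq
  with square+-injective (ℕ.m≤m+n m n) (ℕ.m≤m+n m′ n′) eq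
... | eq′ , refl = refl , ℕ.+-cancelˡ-≡ m n n′ eq′

-- Makes the plateau for `code n m` at least `m` long.
n≤code : ∀ m n → n ℕ.≤ code m n
n≤code m n = ℕ.≤-trans (ℕ.m≤n+m n m)
  (ℕ.≤-trans (m≤m*m (m ℕ.+ n)) (ℕ.m≤m+n _ m))

-- A function on ω with long plateaus at every value.

module Plateaus (em : ExcludedMiddle Level.zero) where

  -- The plateaus are the blocks [ s² , s² + s ]; the one for s = code n m has value n.
  Decodes : ℕ → ℕ → Set
  Decodes x n = ∃[ m ] ∃[ r ] r ℕ.≤ code n m × x ≡ code n m ℕ.* code n m ℕ.+ r

  plateau : ℕ → ℕ
  plateau x with em {∃ (Decodes x)}
  ... | yes (n , _) = n
  ... | no _        = 0

  plateau-≡ : ∀ {x n} → Decodes x n → plateau x ≡ n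
  plateau-≡ {x} {n} (m , r , r≤ , refl) with em {∃ (Decodes x)}
  ... | yes (n′ , m′ , r′ , r′≤ , eq) =
    sym (proj₁ (code-injective {n} {m} {n′} {m′} (proj₁ (square+-injective r≤ r′≤ eq))))
  ... | no ¬p = contradiction (n , m , r , r≤ , refl) ¬p

  plateau-long : ∀ n m → ∃[ k ] (∀ {x} → k ℕ.≤ x → x ℕ.≤ k ℕ.+ m → plateau x ≡ n)
  plateau-long n m = k , λ {x} k≤x x≤k+m → plateau-≡
    ( m , x ℕ.∸ k
    , ℕ.≤-trans (ℕ.m≤n+o⇒m∸n≤o x k x≤k+m) (n≤code n m)
    , sym (ℕ.m+[n∸m]≡n k≤x))
    where k = code n m ℕ.* code n m

module Counting (em : ExcludedMiddle ℓ) where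

  count : (ℕ → Set ℓ) → ℕ → ℕ
  count P zero    = 0
  count P (suc n) with em {P n}
  ... | yes _ = suc (count P n)
  ... | no _  = count P n

  count-≤ : ∀ P n → count P n ℕ.≤ n
  count-≤ P zero    = z≤n
  count-≤ P (suc n) with em {P n}
  ... | yes _ = s≤s (count-≤ P n)
  ... | no _  = ℕ.m≤n⇒m≤1+n (count-≤ P n)

  count-suc : ∀ {P n} → P n → count P (suc n) ≡ suc (count P n)
  count-suc {P} {n} p with em {P n}
  ... | yes _ = refl
  ... | no ¬p = contradiction p ¬p

  count-const : ∀ {P m n} → m ℕ.≤ n → (∀ {j} → m ℕ.≤ j → j ℕ.< n → ¬ P j) →
                count P n ≡ count P m
  count-const {n = zero}  z≤n _ = refl
  count-const {P} {m} {suc n} m≤ ¬P with ℕ.m≤n⇒m<n∨m≡n m≤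
  ... | inj₂ refl = refl
  ... | inj₁ (s≤s m≤n) with em {P n}
  ...   | yes p = contradiction p (¬P m≤n (ℕ.n<1+n n))
  ...   | no _  = count-const m≤n λ m≤j j<n → ¬P m≤j (ℕ.m<n⇒m<1+n j<n)

-- Well-orders, ladders and oscillation.

module WellOrder (em : ExcludedMiddle ℓ) (κ : Ordinal ℓ) where

  open Ordinal κ public
  open IsStrictTotalOrder isStrictTotalOrder public
    using (compare) renaming (trans to <-trans; irrefl to <-irrefl)

  <-irreflexive : ∀ {x} → ¬ x < x
  <-irreflexive = <-irrefl refl

  infix 4 _≤_
  -- Taken as a negation, so that the negative branch of a case split is itself an inequality.
  _≤_ : Carrier → Carrier → Set ℓ
  x ≤ y = ¬ y < x

  <⇒≤ : ∀ {x y} → x < y → x ≤ y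
  <⇒≤ x<y y<x = <-irreflexive (<-trans x<y y<x)

  ≤-<-trans : ∀ {x y z} → x ≤ y → y < z → x < z
  ≤-<-trans {x} {y} {z} x≤y y<z with compare x z
  ... | tri< x<z _ _  = x<z
  ... | tri≈ _ refl _ = contradiction y<z x≤y
  ... | tri> _ _ z<x  = contradiction (<-trans y<z z<x) x≤y

  <-≤-trans : ∀ {x y z} → x < y → y ≤ z → x < z
  <-≤-trans {x} {y} {z} x<y y≤z with compare x z
  ... | tri< x<z _ _  = x<z
  ... | tri≈ _ refl _ = contradiction x<y y≤z
  ... | tri> _ _ z<x  = contradiction (<-trans z<x x<y) y≤z

  ≤-trans : ∀ {x y z} → x ≤ y → y ≤ z → x ≤ z
  ≤-trans x≤y y≤z z<x = x≤y (≤-<-trans y≤z z<x)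

  ≰⇒> : ∀ {x y} → ¬ x ≤ y → y < x
  ≰⇒> = decidable-stable em

  ≤-antisym : ∀ {x y} → x ≤ y → y ≤ x → x ≡ y
  ≤-antisym {x} {y} x≤y y≤x with compare x y
  ... | tri< x<y _ _ = contradiction x<y y≤x
  ... | tri≈ _ eq _  = eq
  ... | tri> _ _ y<x = contradiction y<x x≤y

  least : ∀ (P : Subset κ) {x} → x ∈ P → ∃[ m ] m ∈ P × (∀ {y} → y ∈ P → m ≤ y)
  least P {x} = go (wellFounded x)
    where
    open import Induction.WellFounded using (Acc; acc)
    go : ∀ {x} → Acc _<_ x → x ∈ P → ∃[ m ] m ∈ P × (∀ {y} → y ∈ P → m ≤ y)
    go {x} (acc rs) p with em {∃[ y ] y < x × y ∈ P}
    ... | yes (y , y<x , q) = go (rs y<x) q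
    ... | no ¬q             = x , p , λ {y} q y<x → ¬q (y , y<x , q)

  <-<⁺-trans : ∀ {x y δ} → x < y → [ y ] <⁺ δ → [ x ] <⁺ δ
  <-<⁺-trans x<y = AddSupremum.<⁺-trans _<_ <-trans (AddSupremum.[ x<y ])

  -- Monotonicity is weak because the sequence built in `limit-laddered` may repeat values.
  record IsLadder (α : Carrier) (s : ℕ → Carrier) : Set ℓ where
    field
      mono    : ∀ {i j} → i ℕ.≤ j → s i ≤ s j
      bounded : ∀ i → s i < α
      cofinal : ∀ {η} → η < α → ∃[ i ] η ≤ s i

  ladder : Carrier → ℕ → Carrier
  ladder α with em {∃ (IsLadder α)}
  ... | yes (s , _) = s
  ... | no _        = λ _ → α

  Laddered : Subset κ
  Laddered α = IsLadder α (ladder α)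

  laddered : ∀ {α s} → IsLadder α s → α ∈ Laddered
  laddered {α} {s} l with em {∃ (IsLadder α)}
  ... | yes (_ , l′) = l′
  ... | no ¬l        = contradiction (s , l) ¬l

  open Counting em public

  -- Some ladder point of `α` lies in the half-open interval that ends before `ladder β j` and
  -- starts at the preceding ladder point of `β`; for `j = 0` there is no lower end.
  Crossing : Carrier → Carrier → ℕ → Set ℓ
  Crossing α β j = ∃[ i ] ladder α i < ladder β j × (∀ {k} → k ℕ.< j → ladder β k ≤ ladder α i)

  crossings : Carrier → Carrier → ℕ → ℕ
  crossings α β = count (Crossing α β)

  -- The first j with α ≤ ladder β j; the intervals after it are not counted.
  Reaches : Carrier → Carrier → ℕ → Set ℓ
  Reaches α β j = (∀ {k} → k ℕ.< j → ladder β k < α) × α ≤ ladder β j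

  reaches-unique : ∀ {α β j k} → Reaches α β j → Reaches α β k → j ≡ k
  reaches-unique {j = j} {k} (below-j , α≤j) (below-k , α≤k) with ℕ.<-cmp j k
  ... | tri< j<k _ _  = contradiction (below-k j<k) α≤j
  ... | tri≈ _ j≡k _  = j≡k
  ... | tri> _ _ k<j  = contradiction (below-j k<j) α≤k

  oscillation : Carrier → Carrier → ℕ
  oscillation α β with em {∃ (Reaches α β)}
  ... | yes (j , _) = crossings α β j
  ... | no _        = 0

  oscillation-≡ : ∀ {α β j} → Reaches α β j → oscillation α β ≡ crossings α β j
  oscillation-≡ {α} {β} r with em {∃ (Reaches α β)}
  ... | yes (_ , r′) = cong (crossings α β) (reaches-unique r′ r)
  ... | no ¬r        = contradiction (_ , r) ¬r

-- D plays the role of a set of order type ω₁ which is cofinal in δ.  As δ itself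
-- may have larger cardinality, closure is only asked for functions on D, and the
-- diagonal union in Fodor's lemma is taken over D.
module Stationarity
  (em : ExcludedMiddle ℓ) (κ : Ordinal ℓ) (δ : Ordinal.Carrier⁺ κ) (D : Subset κ)
  (D⊆δ : D ⊆ Below κ δ)
  (x₀ : ∃ (Below κ δ))
  (D-cofinal : ∀ (x : ∃ (Below κ δ)) → Σ[ d ∈ Ordinal.Carrier κ ]
    d ∈ D × Ordinal._<_ κ (proj₁ x) d)
  (sup : ∀ (f : ℕ → ∃ (Below κ δ)) → Σ[ b ∈ ∃ (Below κ δ) ]
    (∀ n → Ordinal._<_ κ (proj₁ (f n)) (proj₁ b)))
  (enumerate : ∀ (x : ∃ (Below κ δ)) → Σ[ e ∈ (ℕ → Ordinal.Carrier κ) ]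
    (∀ {d} → d ∈ D → Ordinal._<_ κ d (proj₁ x) → Σ[ n ∈ ℕ ] e n ≡ d))
  where

  open WellOrder em κ

  -- Bounds below `δ`.

  Point : Set ℓ
  Point = ∃ (Below κ δ)

  above : Carrier → Point
  above x with em {x ∈ Below κ δ}
  ... | yes x<δ = let d , d∈D , _ = D-cofinal (x , x<δ) in d , D⊆δ d∈D
  ... | no _    = x₀

  above-< : ∀ {x} → x ∈ Below κ δ → x < proj₁ (above x)
  above-< {x} x<δ with em {x ∈ Below κ δ}
  ... | yes x<δ = proj₂ (proj₂ (D-cofinal (x , x<δ)))
  ... | no x≮δ  = contradiction x<δ x≮δ

  -- The enumeration may also list elements outside `D`; since `g` is total, these can only raise
  -- the bound.
  bound : (Carrier → Point) → Point → Point
  bound g x = proj₁ (sup (g ∘ proj₁ (enumerate x)))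

  bound-< : ∀ g x {d} → d ∈ D → d < proj₁ x → proj₁ (g d) < proj₁ (bound g x)
  bound-< g x d∈D d<x with proj₂ (enumerate x) d∈D d<x
  ... | n , refl = proj₂ (sup (g ∘ proj₁ (enumerate x))) n

  upper : ∀ (x y : Point) → ∃[ z ] proj₁ x ≤ proj₁ {B = Below κ δ} z × proj₁ y ≤ proj₁ z
  upper x y with compare (proj₁ x) (proj₁ y)
  ... | tri< x<y _ _  = y , <⇒≤ x<y , <-irreflexive
  ... | tri≈ _ refl _ = y , <-irreflexive , <-irreflexive
  ... | tri> _ _ y<x  = x , <-irreflexive , <⇒≤ y<x

  -- Stationary sets and Fodor's lemma.

  Limit : Subset κ
  Limit γ = (∃[ α ] α < γ) × (∀ {η} → η < γ → ∃[ d ] d ∈ D × η < d × d < γ)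

  ClosedUnder : (Carrier → Point) → Subset κ
  ClosedUnder g γ = ∀ d → d ∈ D → d < γ → proj₁ (g d) < γ

  -- Stationarity is tested on closure points of functions instead of clubs: this quantifier stays
  -- in `Set ℓ`, where `em` applies.
  Stationary : Subset κ → Set ℓ
  Stationary S = ∀ g → ∃[ γ ] γ ∈ S × [ γ ] <⁺ δ × Limit γ × ClosedUnder g γ

  Avoids : Subset κ → (Carrier → Point) → Set ℓ
  Avoids S g = ∀ {γ} → γ ∈ S → [ γ ] <⁺ δ → Limit γ → ¬ ClosedUnder g γ

  Nonstationary : Subset κ → Set ℓ
  Nonstationary S = ∃ (Avoids S)

  stationary? : ∀ S → Stationary S ⊎ Nonstationary S
  stationary? S with em {Nonstationary S}
  ... | yes ns = inj₂ ns
  ... | no ¬ns = inj₁ λ g → decidable-stable em λ ¬γ →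
    ¬ns (g , λ γ∈S γ<δ lim cl → ¬γ (_ , γ∈S , γ<δ , lim , cl))

  ¬both : ∀ {S} → Stationary S → ¬ Nonstationary S
  ¬both st (g , avoids) with st g
  ... | _ , γ∈S , γ<δ , lim , cl = avoids γ∈S γ<δ lim cl

  stationary-⊆ : ∀ {S T} → S ⊆ T → Stationary S → Stationary T
  stationary-⊆ S⊆T st g with st g
  ... | γ , γ∈S , rest = γ , S⊆T γ∈S , rest

  inhabited : ∀ {S} → Stationary S → ∃[ x ] proj₁ {B = Below κ δ} x ∈ S
  inhabited st with st (λ _ → x₀)
  ... | γ , γ∈S , γ<δ , _ = (γ , γ<δ) , γ∈S

  -- A point closed under a pointwise upper bound of the witnessing functions is closed under each
  -- of them.
  nonstationary-⋃ : ∀ (T : ℕ → Subset κ) → (∀ n → Nonstationary (T n)) →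
                    Nonstationary (λ γ → ∃[ n ] γ ∈ T n)
  nonstationary-⋃ T ns = (λ d → proj₁ (sup (gs d))) ,
    λ (n , γ∈Tn) γ<δ lim cl → proj₂ (ns n) γ∈Tn γ<δ lim
      λ d d∈D d<γ → <-trans (proj₂ (sup (gs d)) n) (cl d d∈D d<γ)
    where
    gs : Carrier → ℕ → Point
    gs d n = proj₁ (ns n) d

  -- Otherwise `S` is covered by two nonstationary sets, treated as a countable union in which `R`
  -- is repeated.
  stationary-∪ : ∀ {S T R} → S ⊆ (λ γ → γ ∈ T ⊎ γ ∈ R) → Stationary S →
                 Nonstationary R → Stationary T
  stationary-∪ {S} {T} {R} S⊆ st nsR with stationary? T
  ... | inj₁ stT = stT
  ... | inj₂ nsT = ⊥-elim (¬both (stationary-⊆ cover st) (nonstationary-⋃ Q ns))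
    where
    Q : ℕ → Subset κ
    Q zero    = T
    Q (suc _) = R
    ns : ∀ n → Nonstationary (Q n)
    ns zero    = nsT
    ns (suc _) = nsR
    cover : ∀ {γ} → γ ∈ S → ∃[ n ] γ ∈ Q n
    cover γ∈S with S⊆ γ∈S
    ... | inj₁ γ∈T = 0 , γ∈T
    ... | inj₂ γ∈R = 1 , γ∈R

  -- The value at `z` of one function `g` bounds the witness for `d` at `e` for all `d` and `e` in
  -- `D` up to `z`. Below a point closed under `g`, apply this with the larger of `d` and `e` as
  -- `z`.
  nonstationary-diagonal : ∀ (T : Carrier → Subset κ) → (∀ d → Nonstationary (T d)) →
                           Nonstationary (λ γ → ∃[ d ] d ∈ D × d < γ × γ ∈ T d)
  nonstationary-diagonal T ns = g ,
    λ {γ} (d , d∈D , d<γ , γ∈Td) γ<δ lim cl → proj₂ (ns d) γ∈Td γ<δ lim (closed d∈D d<γ cl)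
    where
    -- `bound` only covers arguments strictly below its point, so `above z` is used to include `z`.
    h : Carrier → Carrier → Point
    h z u = bound (proj₁ (ns u)) (above z)
    g : Carrier → Point
    g z = bound (h z) (above z)
    h<g : ∀ {d e z} → z ∈ D → d ∈ D → e ∈ D → d ≤ z → e ≤ z →
          proj₁ (proj₁ (ns d) e) < proj₁ (g z)
    h<g {d} {e} {z} z∈D d∈D e∈D d≤z e≤z = <-trans
      (bound-< (proj₁ (ns d)) (above z) e∈D (≤-<-trans e≤z (above-< (D⊆δ z∈D))))
      (bound-< (h z) (above z) d∈D (≤-<-trans d≤z (above-< (D⊆δ z∈D))))
    closed : ∀ {d γ} → d ∈ D → d < γ → ClosedUnder g γ → ClosedUnder (proj₁ (ns d)) γ
    closed {d} d∈D d<γ cl e e∈D e<γ with compare d e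
    ... | tri< d<e _ _  = <-trans (h<g e∈D d∈D e∈D (<⇒≤ d<e) <-irreflexive) (cl e e∈D e<γ)
    ... | tri≈ _ refl _ = <-trans (h<g d∈D d∈D d∈D <-irreflexive <-irreflexive) (cl d d∈D d<γ)
    ... | tri> _ _ e<d  = <-trans (h<g d∈D d∈D e∈D <-irreflexive (<⇒≤ e<d)) (cl d d∈D d<γ)

  -- Fodor's lemma with a bound in place of a constant value. If every `T d` were nonstationary, so
  -- would be their diagonal union; but a limit `γ` in `S` has some `d` in `D` between `r γ` and
  -- `γ`, so it belongs to that union.
  pressing-down : ∀ {S} (r : Carrier → Carrier) → (∀ {γ} → γ ∈ S → r γ < γ) → Stationary S →
                  ∃[ x ] Stationary (λ γ → γ ∈ S × r γ < proj₁ {B = Below κ δ} x)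
  pressing-down {S} r regressive st = decidable-stable em λ ¬x →
    ¬both st (let g , avoids = nonstationary-diagonal T (ns ¬x) in
      g , λ {γ} γ∈S γ<δ lim → avoids
        (let d , d∈D , rγ<d , d<γ = proj₂ lim (regressive γ∈S) in
          d , d∈D , d<γ , d∈D , γ∈S , rγ<d) γ<δ lim)
    where
    -- The conjunct `d ∈ D` turns the index of a stationary `T d` into a point below `δ`.
    T : Carrier → Subset κ
    T d γ = d ∈ D × γ ∈ S × r γ < d
    ns : ¬ (∃[ x ] Stationary (λ γ → γ ∈ S × r γ < proj₁ {B = Below κ δ} x)) →
         ∀ d → Nonstationary (T d)
    ns ¬x d with stationary? (T d)
    ... | inj₂ nsT = nsT
    ... | inj₁ stT = ⊥-elim (¬x
      ( (d , D⊆δ (proj₁ (proj₂ (inhabited stT))))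
      , stationary-⊆ proj₂ stT))

  -- A limit at or below `x` is not closed under the constant function `x`, because it has elements
  -- of `D` below it.
  stationary-above : ∀ {S} (x : Point) → Stationary S → Stationary (λ γ → γ ∈ S × proj₁ x < γ)
  stationary-above {S} x st = stationary-∪ split st
    ((λ _ → x) , λ γ≤x _ lim cl →
      let d , d∈D , _ , d<γ = proj₂ lim (proj₂ (proj₁ lim)) in γ≤x (cl d d∈D d<γ))
    where
    split : ∀ {γ} → γ ∈ S → (γ ∈ S × proj₁ x < γ) ⊎ γ ≤ proj₁ x
    split {γ} γ∈S with em {proj₁ x < γ}
    ... | yes x<γ = inj₁ (γ∈S , x<γ)
    ... | no x≮γ  = inj₂ x≮γ

  -- Limits of `D` and clubs of closure points.

  -- The ladder is the running maximum of the enumerated entries below `γ`; it is cofinal because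
  -- every element of `D` below `γ` is listed.
  limit-laddered : ∀ {γ} → [ γ ] <⁺ δ → γ ∈ Limit → γ ∈ Laddered
  limit-laddered {γ} γ<δ ((α , α<γ) , dense) = laddered record
    { mono    = mono
    ; bounded = bounded
    ; cofinal = cofinal
    }
    where
    e : ℕ → Carrier
    e = proj₁ (enumerate (γ , γ<δ))
    s : ℕ → Carrier
    s zero    = α
    s (suc n) with em {s n < e n × e n < γ}
    ... | yes _ = e n
    ... | no _  = s n
    s≤s-suc : ∀ n → s n ≤ s (suc n)
    s≤s-suc n with em {s n < e n × e n < γ}
    ... | yes (s<e , _) = <⇒≤ s<e
    ... | no _          = <-irreflexive
    mono : ∀ {i j} → i ℕ.≤ j → s i ≤ s j
    mono {j = zero}  z≤n = <-irreflexive
    mono {j = suc j} i≤ with ℕ.m≤n⇒m<n∨m≡n i≤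
    ... | inj₂ refl      = <-irreflexive
    ... | inj₁ (s≤s i≤j) = ≤-trans (mono i≤j) (s≤s-suc j)
    bounded : ∀ n → s n < γ
    bounded zero    = α<γ
    bounded (suc n) with em {s n < e n × e n < γ}
    ... | yes (_ , e<γ) = e<γ
    ... | no _          = bounded n
    e≤s-suc : ∀ n → e n < γ → e n ≤ s (suc n)
    e≤s-suc n e<γ with em {s n < e n × e n < γ}
    ... | yes _ = <-irreflexive
    ... | no ¬p = λ s<e → ¬p (s<e , e<γ)
    cofinal : ∀ {η} → η < γ → ∃[ n ] η ≤ s n
    cofinal η<γ with dense η<γ
    ... | d , d∈D , η<d , d<γ with proj₂ (enumerate (γ , γ<δ)) d∈D d<γ
    ... | n , refl = suc n , <⇒≤ (<-≤-trans η<d (e≤s-suc n d<γ))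

  -- Stationarity is tested only at limits of `D`, and these have ladders.
  stationary-laddered : ∀ {S} → Stationary S → Stationary (S ∩ Laddered)
  stationary-laddered st g with st g
  ... | γ , γ∈S , γ<δ , lim , cl = γ , (γ∈S , limit-laddered γ<δ lim) , γ<δ , lim , cl

  -- Links `StationaryIn` to `Stationary`. For unboundedness, iterate `next` along ω and take the
  -- supremum.
  closure-club : ∀ g → IsClub κ (λ γ → [ γ ] <⁺ δ × Limit γ × ClosedUnder g γ) δ
  closure-club g = proj₁ , unbounded , closed
    where
    C : Subset κ
    C γ = [ γ ] <⁺ δ × Limit γ × ClosedUnder g γ
    closed : ClosedIn κ C δ
    closed γ γ<δ nonempty unb = γ<δ , (nonempty , dense) , cl
      where
      dense : ∀ {η} → η < γ → ∃[ d ] d ∈ D × η < d × d < γ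
      dense η<γ with unb _ AddSupremum.[ η<γ ]
      ... | β , (_ , lim , _) , η<β , AddSupremum.[ β<γ ] with proj₂ lim η<β
      ... | d , d∈D , η<d , d<β = d , d∈D , η<d , <-trans d<β β<γ
      cl : ClosedUnder g γ
      cl d d∈D d<γ with unb _ AddSupremum.[ d<γ ]
      ... | β , (_ , _ , clβ) , d<β , AddSupremum.[ β<γ ] = <-trans (clβ d d∈D d<β) β<γ
    next : ∀ (x : Point) → ∃[ y ] (∃[ d ] d ∈ D × proj₁ x < d × d < proj₁ {B = Below κ δ} y)
                                × (∀ {d} → d ∈ D → d < proj₁ x → proj₁ (g d) < proj₁ y)
    next x =
      let d , d∈D , x<d = D-cofinal x
          b             = bound g x
          z , d≤z , b≤z = upper (d , D⊆δ d∈D) b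
      in above (proj₁ z)
       , (d , d∈D , x<d , ≤-<-trans d≤z (above-< (proj₂ z)))
       , λ e∈D e<x → <-trans (<-≤-trans (bound-< g x e∈D e<x) b≤z) (above-< (proj₂ z))
    unbounded : UnboundedIn κ C δ
    unbounded α α<δ = γ , (γ<δ , ((α , x<γ 0) , dense) , cl) , x<γ 0 , γ<δ
      where
      x : ℕ → Point
      x zero    = α , α<δ
      x (suc n) = proj₁ (next (x n))
      supremum = least (λ β → ∀ n → proj₁ (x n) < β) (proj₂ (sup x))
      γ = proj₁ supremum
      x<γ : ∀ n → proj₁ (x n) < γ
      x<γ = proj₁ (proj₂ supremum)
      γ<δ : [ γ ] <⁺ δ
      γ<δ with compare γ (proj₁ (proj₁ (sup x)))
      ... | tri< γ<b _ _  = <-<⁺-trans γ<b (proj₂ (proj₁ (sup x)))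
      ... | tri≈ _ eq _   = subst (λ z → [ z ] <⁺ δ) (sym eq) (proj₂ (proj₁ (sup x)))
      ... | tri> _ _ b<γ  = contradiction b<γ (proj₂ (proj₂ supremum) (proj₂ (sup x)))
      reach : ∀ {η} → η < γ → ∃[ n ] η ≤ proj₁ (x n)
      reach {η} η<γ = decidable-stable em λ ¬n →
        proj₂ (proj₂ supremum) (λ n → ≰⇒> λ η≤x → ¬n (n , η≤x)) η<γ
      dense : ∀ {η} → η < γ → ∃[ d ] d ∈ D × η < d × d < γ
      dense η<γ with reach η<γ
      ... | n , η≤x with proj₁ (proj₂ (next (x n)))
      ... | d , d∈D , x<d , d<x = d , d∈D , ≤-<-trans η≤x x<d , <-trans d<x (x<γ (suc n))
      cl : ClosedUnder g γ
      cl d d∈D d<γ with reach d<γ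
      ... | n , d≤x with proj₁ (proj₂ (next (x n)))
      -- `d` is strictly below `x (suc n)`, so its value under `g` is caught one term later.
      ... | e , _ , x<e , e<x = <-trans
        (proj₂ (proj₂ (next (x (suc n)))) d∈D (≤-<-trans d≤x (<-trans x<e e<x)))
        (x<γ (2 ℕ.+ n))

  stationaryIn⇒stationary : ∀ {S} → StationaryIn κ S δ → Stationary S
  stationaryIn⇒stationary st g with st _ (closure-club g)
  ... | γ , γ∈S , _ , γ<δ , lim , cl = γ , γ∈S , γ<δ , lim , cl

  -- Free and bounded levels of ladders.

  Ready : Subset κ → ℕ → Set ℓ
  Ready S n = ∀ (x : Point) → Stationary (λ γ → γ ∈ S × proj₁ x ≤ ladder γ n)

  ready? : ∀ S n → Ready S n ⊎
           ∃[ x ] Nonstationary (λ γ → γ ∈ S × proj₁ {B = Below κ δ} x ≤ ladder γ n)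
  ready? S n with em {∃[ x ] Nonstationary (λ γ → γ ∈ S × proj₁ {B = Below κ δ} x ≤ ladder γ n)}
  ... | yes p = inj₂ p
  ... | no ¬p = inj₁ λ x → stationary x (stationary? _)
    where
    stationary : ∀ (x : Point) → let T = λ γ → γ ∈ S × proj₁ x ≤ ladder γ n in
                 Stationary T ⊎ Nonstationary T → Stationary T
    stationary x (inj₁ st) = st
    stationary x (inj₂ ns) = contradiction (x , ns) ¬p

  -- Otherwise each level `n` reaches some `x n` only on a nonstationary set. By cofinality, every
  -- element of `S` above a common bound of the `x n` reaches `x n` at some level `n`, so
  -- stationarily many elements lie in a countable union of nonstationary sets.
  ready-exists : ∀ {S} → S ⊆ Laddered → Stationary S → ∃ (Ready S)
  ready-exists {S} S⊆L st = decidable-stable em λ ¬ready →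
    let x  = λ n → proj₁ (unready ¬ready n)
        y  = sup x
    in ¬both (stationary-above (proj₁ y) st)
       (let g , avoids = nonstationary-⋃ (λ n γ → γ ∈ S × proj₁ (x n) ≤ ladder γ n)
                                         (λ n → proj₂ (unready ¬ready n)) in
        g , λ (γ∈S , y<γ) → avoids
          (let n , y≤s = IsLadder.cofinal (S⊆L γ∈S) y<γ in
           n , γ∈S , ≤-trans (<⇒≤ (proj₂ y n)) y≤s))
    where
    unready : ¬ ∃ (Ready S) → ∀ n →
              ∃[ x ] Nonstationary (λ γ → γ ∈ S × proj₁ {B = Below κ δ} x ≤ ladder γ n)
    unready ¬ready n with ready? S n
    ... | inj₁ r = contradiction (n , r) ¬ready
    ... | inj₂ u = u

  BoundedBy : Subset κ → ℕ → Point → Set ℓ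
  BoundedBy S n x = ∀ {γ} → γ ∈ S → ∀ {i} → i ℕ.< n → ladder γ i < proj₁ x

  record Settled (S : Subset κ) : Set (Level.suc ℓ) where
    field
      T       : Subset κ
      T⊆S     : T ⊆ S
      n       : ℕ
      x       : Point
      ready   : Ready T n
      bounded : BoundedBy T n x

  -- Descend from a ready level while the level before it is ready too. At the first failure,
  -- discard the nonstationary set where that level is high: the next level stays ready, and
  -- monotonicity bounds all earlier ones.
  settle : ∀ {S} → S ⊆ Laddered → Stationary S → Settled S
  settle {S} S⊆L st = go (proj₁ r) (proj₂ r)
    where
    r = ready-exists S⊆L st
    go : ∀ n → Ready S n → Settled S
    go zero    rd = record
      { T = S ; T⊆S = λ γ∈S → γ∈S ; n = 0 ; x = x₀ ; ready = rd ; bounded = λ _ () }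
    go (suc n) rd with ready? S n
    ... | inj₁ rd′      = go n rd′
    ... | inj₂ (x , ns) = record
      { T       = λ γ → γ ∈ S × ladder γ n < proj₁ x
      ; T⊆S     = proj₁
      ; n       = suc n
      ; x       = x
      ; ready   = λ y → stationary-∪ (split y) (rd y) ns
      ; bounded = λ (γ∈S , s<x) i≤n →
          ≤-<-trans (IsLadder.mono (S⊆L γ∈S) (ℕ.m<1+n⇒m≤n i≤n)) s<x
      }
      where
      split : ∀ (y : Point) {γ} → γ ∈ S × proj₁ y ≤ ladder γ (suc n) →
              ((γ ∈ S × ladder γ n < proj₁ x) × proj₁ y ≤ ladder γ (suc n)) ⊎
              (γ ∈ S × proj₁ x ≤ ladder γ n)
      split y {γ} (γ∈S , y≤s) with em {ladder γ n < proj₁ x}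
      ... | yes s<x = inj₁ ((γ∈S , s<x) , y≤s)
      ... | no s≮x  = inj₂ (γ∈S , s≮x)

  record Advance (S : Subset κ) (n : ℕ) (x : Point) : Set (Level.suc ℓ) where
    field
      T       : Subset κ
      T⊆S     : T ⊆ S
      n′      : ℕ
      n<n′    : n ℕ.< n′
      y       : Point
      x<y     : proj₁ x < proj₁ y
      ready   : Ready T n′
      jumped  : ∀ {γ} → γ ∈ T → proj₁ x ≤ ladder γ n
      bounded : BoundedBy T n′ y

  -- Keep the elements whose point `n` is at or above `x`, press that point down below some `z`, and
  -- settle again.
  advance : ∀ {S n} → S ⊆ Laddered → Ready S n → ∀ x → Advance S n x
  advance {S} {n} S⊆L rd x
    with pressing-down (λ γ → ladder γ n) (λ (γ∈S , _) → IsLadder.bounded (S⊆L γ∈S) n) (rd x)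
  ... | z , st = record
    { T       = T
    ; T⊆S     = proj₁ ∘ proj₁ ∘ T⊆S
    ; n′      = n′
    ; n<n′    = n<n′
    ; y       = y
    ; x<y     = let _ , γ∈T , _ = inhabited (ready z) in
                ≤-<-trans (proj₂ (proj₁ (T⊆S γ∈T))) (bounded γ∈T n<n′)
    ; ready   = ready
    ; jumped  = proj₂ ∘ proj₁ ∘ T⊆S
    ; bounded = bounded
    }
    where
    open Settled (settle (S⊆L ∘ proj₁ ∘ proj₁) st) renaming (n to n′; x to y)
    -- Point `n` is below `z` throughout `T`, while point `n′` reaches `z` for some element.
    n<n′ : n ℕ.< n′
    n<n′ = ℕ.≰⇒> λ n′≤n →
      let _ , γ∈T , z≤s = inhabited (ready z)
          (γ∈S , _) , s<z = T⊆S γ∈T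
      in z≤s (≤-<-trans (IsLadder.mono (S⊆L γ∈S) n′≤n) s<z)

  -- Alternating extension of the two sides.

  -- Under the premise of `crossed`, the points of `α` from `m` on lie above the first `n` points of
  -- `β`, so only bounded initial segments enter the count.
  record Stage (A B : Subset κ) (lo hi : ℕ) : Set (Level.suc ℓ) where
    field
      S T      : Subset κ
      S⊆A      : S ⊆ A
      T⊆B      : T ⊆ B
      m n      : ℕ
      x        : Point
      readyS   : Ready S m
      readyT   : Ready T n
      boundedS : BoundedBy S m x
      boundedT : BoundedBy T n x
      crossed  : ∀ {α β} → α ∈ S → β ∈ T → proj₁ x ≤ ladder α m →
                 lo ℕ.≤ crossings α β n × crossings α β n ℕ.≤ hi

  module _ {A B : Subset κ} (A⊆L : A ⊆ Laddered) (B⊆L : B ⊆ Laddered) where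

    -- How the first initial segments interleave is not controlled; they contribute between 0 and
    -- `SB.n`, and this is the error.
    initial : Stationary A → Stationary B → ∃[ k ] Stage A B 0 k
    initial stA stB = SB.n , record
      { S = SA.T ; T = SB.T ; S⊆A = SA.T⊆S ; T⊆B = SB.T⊆S
      ; m = SA.n ; n = SB.n ; x = z
      ; readyS   = SA.ready
      ; readyT   = SB.ready
      ; boundedS = λ α∈S i<m → <-≤-trans (SA.bounded α∈S i<m) (proj₁ (proj₂ u))
      ; boundedT = λ β∈T i<n → <-≤-trans (SB.bounded β∈T i<n) (proj₂ (proj₂ u))
      ; crossed  = λ {α} {β} _ _ _ → z≤n , count-≤ (Crossing α β) SB.n
      }
      where
      module SA = Settled (settle A⊆L stA)
      module SB = Settled (settle B⊆L stB)
      u = upper SA.x SB.x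
      z = proj₁ u

    -- The new points of `α` lie in `[x, SA.y)` and those of `β` in `[SA.y, SB.y)`. Under the
    -- premise of the new `crossed`, all later points of `α` are at or above `SB.y`, so exactly one
    -- more interval is crossed.
    next-stage : ∀ {lo hi} → Stage A B lo hi → Stage A B (suc lo) (suc hi)
    next-stage {lo} {hi} stage = record
      { S = SA.T ; T = SB.T ; S⊆A = S⊆A ∘ SA.T⊆S ; T⊆B = T⊆B ∘ SB.T⊆S
      ; m = SA.n′ ; n = SB.n′ ; x = SB.y
      ; readyS   = SA.ready
      ; readyT   = SB.ready
      ; boundedS = λ α∈S i<m → <-trans (SA.bounded α∈S i<m) SB.x<y
      ; boundedT = SB.bounded
      ; crossed  = λ α∈S β∈T y≤s →
          let below , above = crossed (SA.T⊆S α∈S) (SB.T⊆S β∈T) (SA.jumped α∈S)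
              eq            = crossings-suc α∈S β∈T y≤s
          in subst (suc lo ℕ.≤_) (sym eq) (s≤s below) , subst (ℕ._≤ suc hi) (sym eq) (s≤s above)
      }
      where
      open Stage stage
      module SA = Advance (advance (A⊆L ∘ S⊆A) readyS x)
      module SB = Advance (advance (B⊆L ∘ T⊆B) readyT SA.y)
      crossings-suc : ∀ {α β} → α ∈ SA.T → β ∈ SB.T → proj₁ SB.y ≤ ladder α SA.n′ →
                      crossings α β SB.n′ ≡ suc (crossings α β n)
      crossings-suc {α} {β} α∈S β∈T y≤s = trans (count-const SB.n<n′ tail) (count-suc head)
        where
        head : Crossing α β n
        head = m , <-≤-trans (SA.bounded α∈S SA.n<n′) (SB.jumped β∈T)
             , λ k<n → <⇒≤ (<-≤-trans (boundedT (SB.T⊆S β∈T) k<n) (SA.jumped α∈S))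
        -- A crossing point would be below `SB.y`, hence among the first `SA.n′` points of `α`,
        -- hence below `ladder β n`.
        tail : ∀ {j} → suc n ℕ.≤ j → j ℕ.< SB.n′ → ¬ Crossing α β j
        tail n<j j<n′ (i , s<t , t≤s) =
          t≤s n<j (<-≤-trans (SA.bounded α∈S i<m′) (SB.jumped β∈T))
          where
          i<m′ : i ℕ.< SA.n′
          i<m′ = ℕ.≰⇒> λ m′≤i → y≤s (≤-<-trans
            (IsLadder.mono (A⊆L (S⊆A (SA.T⊆S α∈S))) m′≤i)
            (<-trans s<t (SB.bounded β∈T j<n′)))

    -- The width `k` comes from the initial stage and is the same for all `n`.
    stage-at : Stationary A → Stationary B → ∃[ k ] (∀ n → Stage A B n (n ℕ.+ k))
    stage-at stA stB = proj₁ (initial stA stB) , go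
      where
      go : ∀ n → Stage A B n (n ℕ.+ proj₁ (initial stA stB))
      go zero    = proj₂ (initial stA stB)
      go (suc n) = next-stage (go n)

    -- Choose `α` first, then `β` with `ladder β n` at or above `α`. The earlier points of `β` are
    -- below `x`, hence below `α`, so the oscillation counts exactly the first `n` intervals.
    oscillation-in : ∀ {lo hi} → Stage A B lo hi →
      ∃[ α ] ∃[ β ] α ∈ A × β ∈ B × α < β ×
        lo ℕ.≤ oscillation α β × oscillation α β ℕ.≤ hi
    oscillation-in {lo} {hi} stage
      with (α , α<δ) , α∈S , x≤s ← inhabited (Stage.readyS stage (Stage.x stage))
      with (β , _) , β∈T , α≤t ← inhabited (Stage.readyT stage (α , α<δ))
      = α , β , S⊆A α∈S , T⊆B β∈T
      , ≤-<-trans α≤t (IsLadder.bounded (B⊆L (T⊆B β∈T)) n)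
      , subst (λ c → lo ℕ.≤ c × c ℕ.≤ hi) (sym (oscillation-≡ reaches)) (crossed α∈S β∈T x≤s)
      where
      open Stage stage
      reaches : Reaches α β n
      reaches = (λ k<n → <-trans (<-≤-trans (boundedT β∈T k<n) x≤s)
                                 (IsLadder.bounded (A⊆L (S⊆A α∈S)) m))
              , α≤t

-- Sets of order type ω₁ and their suprema.

module OrderTypeω₁
  (em : ExcludedMiddle ℓ) (κ : Ordinal ℓ) (δ : Ordinal.Carrier⁺ κ) (A : Subset κ)
  (A-ω₁ : HasOrderTypeω₁ κ A) (A-sup : IsSup κ A δ) where

  open WellOrder em κ

  τ : Carrier⁺
  τ = proj₁ A-ω₁

  uncountable : ¬ Countable κ (Below κ τ)
  uncountable = proj₁ (proj₁ (proj₂ A-ω₁))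

  initial-countable : ∀ (ξ : ∃ (Below κ τ)) → Countable κ (Below κ [ proj₁ ξ ])
  initial-countable (ξ , ξ<τ) = proj₂ (proj₁ (proj₂ A-ω₁)) ξ ξ<τ

  f : ∃ (Below κ τ) → ∃ A
  f = proj₁ (proj₂ (proj₂ A-ω₁))

  open IsOrderIsomorphism (proj₂ (proj₂ (proj₂ A-ω₁)))
    using (surjective; mono; cancel) renaming (cong to f-cong)

  f⁻¹ : ∃ A → ∃ (Below κ τ)
  f⁻¹ a = proj₁ (surjective a)

  f∘f⁻¹ : ∀ a → proj₁ (f (f⁻¹ a)) ≡ proj₁ a
  f∘f⁻¹ a = proj₂ (surjective a) refl

  f-mono-≤ : ∀ {ξ η} → proj₁ (f ξ) ≤ proj₁ (f η) → proj₁ ξ ≤ proj₁ η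
  f-mono-≤ fξ≤fη η<ξ = fξ≤fη (mono η<ξ)

  -- The number 0 is reserved for `ξ` itself, since `Covers` in `dominate` is a weak inequality.
  index : ∀ (ξ : ∃ (Below κ τ)) → Carrier → ℕ
  index ξ η with em {η < proj₁ ξ}
  ... | yes η<ξ = suc (Injection.to (initial-countable ξ) (η , AddSupremum.[ η<ξ ]))
  ... | no _    = 0

  index-injective : ∀ (ξ : ∃ (Below κ τ)) {η ζ} → η ≤ proj₁ ξ → ζ ≤ proj₁ ξ →
                    index ξ η ≡ index ξ ζ → η ≡ ζ
  index-injective ξ {η} {ζ} η≤ξ ζ≤ξ eq with em {η < proj₁ ξ} | em {ζ < proj₁ ξ}
  ... | yes η<ξ | yes ζ<ξ = Injection.injective (initial-countable ξ) (ℕ.suc-injective eq)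
  ... | no η≮ξ  | no ζ≮ξ  = trans (≤-antisym η≤ξ η≮ξ) (≤-antisym ζ≮ξ ζ≤ξ)

  -- Regularity of ω₁: a cofinal sequence would cover `Below κ τ` by countably many countable
  -- initial segments, and pairing a segment with a position in it would make `Below κ τ` countable.
  dominate : ∀ (s : ℕ → ∃ A) → ∃[ a ] a ∈ A × (∀ n → proj₁ (s n) < a)
  dominate s = decidable-stable em λ undominated →
    uncountable record
      { to        = to ∘ proj₁
      ; cong      = cong to
      ; injective = λ {ξ} {η} eq → to-injective
          (covered undominated (proj₁ ξ) (proj₂ ξ)) (covered undominated (proj₁ η) (proj₂ η)) eq
      }
    where
    Covers : Carrier → ℕ → Set ℓ
    Covers ξ n = ξ ≤ proj₁ (f⁻¹ (s n))
    -- Chosen from ξ alone, since the proof of ξ < τ need not be unique.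
    choose : Carrier → ℕ
    choose ξ with em {∃ (Covers ξ)}
    ... | yes (n , _) = n
    ... | no _        = 0
    choose-covers : ∀ {ξ} → ∃ (Covers ξ) → Covers ξ (choose ξ)
    choose-covers {ξ} c with em {∃ (Covers ξ)}
    ... | yes (_ , c′) = c′
    ... | no ¬c        = contradiction c ¬c
    to : Carrier → ℕ
    to ξ = code (choose ξ) (index (f⁻¹ (s (choose ξ))) ξ)
    same : ∀ {ξ η} m n → m ≡ n → Covers ξ m → Covers η n →
           index (f⁻¹ (s m)) ξ ≡ index (f⁻¹ (s n)) η → ξ ≡ η
    same m .m refl = index-injective (f⁻¹ (s m))
    to-injective : ∀ {ξ η} → ∃ (Covers ξ) → ∃ (Covers η) → to ξ ≡ to η → ξ ≡ η
    to-injective {ξ} {η} cξ cη eq =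
      let m≡n , i≡j = code-injective {choose ξ} {_} {choose η} eq in
      same (choose ξ) (choose η) m≡n (choose-covers cξ) (choose-covers cη) i≡j
    covered : ¬ (∃[ a ] a ∈ A × (∀ n → proj₁ (s n) < a)) →
              ∀ ξ → ξ ∈ Below κ τ → ∃ (Covers ξ)
    covered undominated ξ ξ<τ = decidable-stable em λ ¬c → undominated
      ( proj₁ (f (ξ , ξ<τ)) , proj₂ (f (ξ , ξ<τ))
      , λ n → ≰⇒> λ fξ≤s → ¬c
          (n , f-mono-≤ (subst (proj₁ (f (ξ , ξ<τ)) ≤_) (sym (f∘f⁻¹ (s n))) fξ≤s)))

  beyond : ∀ (a : ∃ A) → ∃[ b ] b ∈ A × proj₁ a < b
  beyond a = let b , b∈A , a<b = dominate (λ _ → a) in b , b∈A , a<b 0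

  -- `A` has no largest element, so its supremum is not attained.
  A⊆δ : A ⊆ Below κ δ
  A⊆δ a∈A with beyond (_ , a∈A)
  ... | b , b∈A , a<b with proj₁ A-sup b b∈A
  ... | inj₁ b<δ  = <-<⁺-trans a<b b<δ
  ... | inj₂ refl = AddSupremum.[ a<b ]

  A-cofinal : ∀ (x : ∃ (Below κ δ)) → ∃[ a ] a ∈ A × proj₁ x < a
  A-cofinal (x , x<δ) = decidable-stable em λ ¬a →
    absurd (proj₂ A-sup [ x ] (upper-bound ¬a))
    where
    upper-bound : ¬ (∃[ a ] a ∈ A × x < a) → UpperBound κ A [ x ]
    upper-bound ¬a α α∈A with compare α x
    ... | tri< α<x _ _ = inj₁ AddSupremum.[ α<x ]
    ... | tri≈ _ eq _  = inj₂ (cong [_] eq)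
    ... | tri> _ _ x<α = contradiction (α , α∈A , x<α) ¬a
    absurd : ¬ (δ ≤⁺ [ x ])
    absurd (inj₁ δ<x)  = AddSupremum.<⁺-asym _<_ (λ p q → <-irreflexive (<-trans p q)) x<δ δ<x
    absurd (inj₂ refl) = <-irreflexive (AddSupremum.[<]-injective _<_ x<δ)

  sup : ∀ (s : ℕ → ∃ (Below κ δ)) → Σ[ b ∈ ∃ (Below κ δ) ] (∀ n → proj₁ (s n) < proj₁ b)
  sup s =
    let b , b∈A , s<b = dominate (λ n → let a , a∈A , _ = A-cofinal (s n) in a , a∈A)
    in (b , A⊆δ b∈A) , λ n → <-trans (proj₂ (proj₂ (A-cofinal (s n)))) (s<b n)

  module _ (x : ∃ (Below κ δ)) where

    a₀ : ∃ A
    a₀ = let a , a∈A , _ = A-cofinal x in a , a∈A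

    -- The elements of `A` below `x` have their preimages below that of `a₀`, in a countable initial
    -- segment whose numbering is reused here.
    Indexed : ℕ → Subset κ
    Indexed n d = ∃[ ξ ] proj₁ (f ξ) ≡ d × Σ[ ξ<ξ₀ ∈ proj₁ ξ < proj₁ (f⁻¹ a₀) ]
      Injection.to (initial-countable (f⁻¹ a₀)) (proj₁ ξ , AddSupremum.[ ξ<ξ₀ ]) ≡ n

    enum : ℕ → Carrier
    enum n with em {∃ (Indexed n)}
    ... | yes (d , _) = d
    ... | no _        = proj₁ x

    enum-≡ : ∀ {n d} → d ∈ Indexed n → enum n ≡ d
    enum-≡ {n} (ξ , refl , _ , eq) with em {∃ (Indexed n)}
    ... | yes (_ , ξ′ , refl , _ , eq′) = f-cong
      (Injection.injective (initial-countable (f⁻¹ a₀)) (trans eq′ (sym eq)))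
    ... | no ¬p = contradiction (_ , ξ , refl , _ , eq) ¬p

    enum-surjective : ∀ {d} → d ∈ A → d < proj₁ x → Σ[ n ∈ ℕ ] enum n ≡ d
    enum-surjective {d} d∈A d<x = _ , enum-≡ (f⁻¹ (d , d∈A) , f∘f⁻¹ (d , d∈A) , ξ<ξ₀ , refl)
      where
      d<a₀ : d < proj₁ a₀
      d<a₀ = <-trans d<x (proj₂ (proj₂ (A-cofinal x)))
      ξ<ξ₀ : proj₁ (f⁻¹ (d , d∈A)) < proj₁ (f⁻¹ a₀)
      ξ<ξ₀ = cancel (subst₂ _<_ (sym (f∘f⁻¹ (d , d∈A))) (sym (f∘f⁻¹ a₀)) d<a₀)

  δ-inhabited : ∃ (Below κ δ)
  δ-inhabited = decidable-stable em λ empty → uncountable record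
    { to        = λ _ → 0
    ; cong      = λ _ → refl
    ; injective = λ {ξ} _ → contradiction (_ , A⊆δ (proj₂ (f ξ))) empty
    }

  module ω₁-Stationarity = Stationarity em κ δ A A⊆δ δ-inhabited A-cofinal sup
    (λ x → enum x , enum-surjective x)

theorem1p1 : ∀ {ℓ : Level} → ExcludedMiddle (Level.suc ℓ) →
    (κ : Ordinal ℓ) → IsCardinal κ → IsUncountable κ →
    Σ[ c ∈ Coloring κ ]
    (∀ (A B : Subset κ) (δ : Ordinal.Carrier⁺ κ) →
    HasOrderTypeω₁ κ A → HasOrderTypeω₁ κ B →
    IsSup κ A δ → IsSup κ B δ →
    StationaryIn κ A δ → StationaryIn κ B δ →
    Image κ c (_⊗_ κ A B) ≐ U)
theorem1p1 {ℓ} em κ _ _ = c , λ A B δ A-ω₁ _ A-sup _ A-stat B-stat →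
    (λ _ → tt) , λ {n} _ →
      let open OrderTypeω₁ em′ κ δ A A-ω₁ A-sup using (module ω₁-Stationarity)
          open ω₁-Stationarity
          -- The error `m` is fixed first. Then `k` starts a plateau of value `n` on `[k, k + m]`,
          -- and stage `k` places the oscillation there.
          m , stage = stage-at proj₂ proj₂
            (stationary-laddered (stationaryIn⇒stationary A-stat))
            (stationary-laddered (stationaryIn⇒stationary B-stat))
          k , constant = plateau-long n m
          α , β , (α∈A , _) , (β∈B , _) , α<β , k≤osc , osc≤k+m =
            oscillation-in proj₂ proj₂ (stage k)
      in pair α β α<β , (α∈A , β∈B) , constant k≤osc osc≤k+m
  where
  em′ : ExcludedMiddle ℓ
  em′ = lowerEM {b = Level.suc ℓ} em
  open WellOrder em′ κ using (oscillation)
  open Plateaus (lowerEM {b = Level.suc ℓ} em)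
  c : Coloring κ
  c (pair α β _) = plateau (oscillation α β)
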